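{- Let $n,k$ be integers with $3\le k\le n-1$, $n>2k$ and $n$ odd. Then the number $w_{n,k}$ of vertices of $G(n)$ contained in some closed $k$-walk satisfies \[w_{n,k}\le \frac{(n-2)!}{(n-k)!}\left(\left(n+\frac12\right)(n+1)(n-1)+k+\frac{n-5}{2}-2-(n-1)\left\lceil\frac{n-1}{4}\right\rceil\right).\]
   Context: For a sequence of distinct integers $c_1\cdots c_t$, $\mathrm{st}(c_1\cdots c_t)$ is the unique permutation $d_1\cdots d_t$ of $\{1,\dots,t\}$ with $d_i<d_j$ iff $c_i<c_j$. $G(n)$ is the directed multigraph whose vertices are the permutations of $\{1,\dots,n\}$ (one-line notation) and whose edges are the permutations $c_1\cdots c_{n+1}$ of $\{1,\dots,n+1\}$, the edge $c_1\cdots c_{n+1}$ going from $\mathrm{st}(c_1\cdots c_n)$ to $\mathrm{st}(c_2\cdots c_{n+1})$; so there is an edge from $x_1\cdots x_n$ to $w_1\cdots w_n$ iff $\mathrm{st}(x_2\cdots x_n)=\mathrm{st}(w_1\cdots w_{n-1})$. A closed $k$-walk $(v_1,\dots,v_k)$ is a sequence of vertices with an edge from $v_i$ to $v_{i+1}$ for $i<k$ and from $v_k$ to $v_1$. -}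

module Defs where

open import Data.Nat using (ℕ; zero; suc; _+_; _*_; _∸_; _<?_; _≤_)
open import Data.Nat.DivMod using (_/_)
open import Data.Fin using (Fin; toℕ)
open import Data.List using (List; map; length; filter; take; drop; upTo)
open import Data.List.Relation.Binary.Permutation.Propositional using (_↭_)
open import Data.List.Relation.Unary.Any using (Any)
open import Data.Product using (Σ; ∃; _×_)
open import Relation.Binary.PropositionalEquality using (_≡_)

[1‥_] : ℕ → List ℕ
[1‥ n ] = map suc (upTo n)

IsPerm : ℕ → List ℕ → Set
IsPerm n xs = xs ↭ [1‥ n ]

-- Standardization st(c_1 ... c_t): the i-th entry is 1 + #{j : c_j < c_i}.
-- For sequences of distinct integers this is the unique permutation d of
-- {1,...,t} with d_i < d_j iff c_i < c_j.
st : List ℕ → List ℕ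
st cs = map (λ c → suc (length (filter (_<? c) cs))) cs

Edge : ℕ → List ℕ → List ℕ → Set
Edge n x w = Σ (List ℕ) λ c →
  IsPerm (suc n) c × st (take n c) ≡ x × st (drop 1 c) ≡ w

-- A closed k-walk (v_1, ..., v_k) in G(n), indexed by Fin k (index i ↦ v_{i+1}):
-- all v_i are vertices, an edge from v_i to v_{i+1} for i < k, and from v_k to v_1.
ClosedWalk : ℕ → (k : ℕ) → (Fin k → List ℕ) → Set
ClosedWalk n k v =
  (∀ i → IsPerm n (v i)) ×
  (∀ (i j : Fin k) → suc (toℕ i) ≡ toℕ j → Edge n (v i) (v j)) ×
  (∀ (i j : Fin k) → suc (toℕ i) ≡ k → toℕ j ≡ 0 → Edge n (v i) (v j))

InClosedWalk : ℕ → ℕ → List ℕ → Set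
InClosedWalk n k x =
  IsPerm n x × (Σ (Fin k → List ℕ) λ v → ClosedWalk n k v × ∃ λ i → v i ≡ x)

⌈_/4⌉ : ℕ → ℕ
⌈ m /4⌉ = (m + 3) / 4

{-# OPTIONS --safe #-}

-- Walking once around a closed k-walk shows st(x_1..x_{n-k}) = st(x_{k+1}..x_n): the
-- order of the entries is invariant under shifting positions by k.  Such a permutation
-- is determined by its first k entries, so there are at most n!/(n-k)! of them, which
-- is below the claimed bound.
--
-- For the determination, call p mod k the head of position p.  By shift invariance,
-- no value c can be crossed both by a chain p mod k, p mod k + k, ... going up and by
-- one going down.  Hence the number of positions with head value ≤ c, minus the number
-- of positions with value ≤ c, is positive where some chain crosses c upwards and
-- negative where some chain crosses it downwards; as this difference depends only on
-- the heads, the directions agree for two permutations with the same first k entries.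
-- Within the rising chains, the values are then forced in increasing order (the
-- smallest pending predecessor is continued first), and the falling ones follow by
-- complementing all values.
module Submission where

open import Defs
open import Data.Nat using (ℕ; suc; _≤_; _<_; _∸_; _%_; _!)
open import Data.Integer using (ℤ; +_; _+_; _-_; _*_) renaming (_≤_ to _≤ℤ_)
open import Data.List using (List; length)
open import Data.List.Relation.Unary.All using (All)
open import Data.List.Relation.Unary.Unique.Propositional using (Unique)
open import Relation.Binary.PropositionalEquality using (_≡_)

open import Data.Nat as ℕ using (zero; _≤?_; _<?_; z≤n; s≤s; NonZero)
open import Data.Nat.Properties
open import Data.Nat.DivMod using ([m+n]%n≡m%n; m<n⇒m%n≡m; m%n<n; m%n≤m; m<n*o⇒m/o<n)
open import Data.Nat.Induction using (<-rec)
open import Data.Nat.Tactic.RingSolver using () renaming (solve-∀ to ℕ-solve-∀)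
import Data.Integer as ℤ
import Data.Integer.Properties as ℤ
open import Data.Integer.Tactic.RingSolver using () renaming (solve-∀ to ℤ-solve-∀)
open import Data.Fin using (Fin; toℕ; fromℕ; fromℕ<)
open import Data.Fin.Properties using (toℕ<n; toℕ-fromℕ; toℕ-fromℕ<; toℕ-injective; injective⇒≤)
open import Data.List using ([]; _∷_; _++_; map; concatMap; filter; take; drop; lookup; applyUpTo; upTo)
open import Data.List.Membership.Propositional using (_∈_)
open import Data.List.Membership.Propositional.Properties
  using (∈-applyUpTo⁺; ∈-applyUpTo⁻; ∈-upTo⁺; ∈-upTo⁻; ∈-map⁺; ∈-map⁻; ∈-concatMap⁺; ∈-filter⁺; ∈-lookup)
open import Data.List.Membership.Setoid.Properties using (index-injective)
open import Data.List.Properties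
  using (map-applyUpTo; map-upTo; filter-accept; filter-reject; filter-notAll; length-map; length-upTo; length-take; length-drop; length-++)
open import Data.List.Relation.Binary.Permutation.Propositional using (_↭_; ↭-sym; ↭-trans; ↭⇒↭ₛ)
open import Data.List.Relation.Binary.Permutation.Propositional.Properties using (∈-resp-↭; filter-↭; ↭-length; map⁺)
open import Data.List.Relation.Binary.Permutation.Setoid.Properties using (Unique-resp-↭)
import Data.List.Relation.Unary.All as All
import Data.List.Relation.Unary.All.Properties as All
open import Data.List.Relation.Unary.AllPairs using ([]; _∷_)
open import Data.List.Relation.Unary.Any as Any using (here; there)
import Data.List.Relation.Unary.Unique.Propositional.Properties as Unique
open import Data.Product using (∃; _×_; _,_; proj₁; proj₂)
open import Data.Sum using (_⊎_; inj₁; inj₂)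
open import Data.Empty using (⊥; ⊥-elim)
open import Function using (_∘_)
open import Relation.Binary using (tri<; tri≈; tri>)
open import Relation.Binary.PropositionalEquality
  using (refl; sym; trans; cong; cong₂; subst; subst₂; setoid; module ≡-Reasoning)
open import Relation.Nullary using (¬_; ¬?; yes; no; contradiction)
open import Relation.Unary using (Decidable)

-- Lengths of filtered lists.

module _ {A : Set} {P Q : A → Set} (P? : Decidable P) (Q? : Decidable Q) where

  length-filter-mono : ∀ xs → (∀ {z} → z ∈ xs → P z → Q z) →
    length (filter P? xs) ≤ length (filter Q? xs)
  length-filter-mono [] P⇒Q = z≤n
  length-filter-mono (z ∷ xs) P⇒Q with ih ← length-filter-mono xs (P⇒Q ∘ there) | P? z | Q? z
  ... | yes _ | yes _ = s≤s ih
  ... | yes p | no ¬q = contradiction (P⇒Q (here refl) p) ¬q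
  ... | no _  | yes _ = m≤n⇒m≤1+n ih
  ... | no _  | no _  = ih

  length-filter-mono-< : ∀ xs → (∀ {z} → z ∈ xs → P z → Q z) →
    ∀ {z} → z ∈ xs → ¬ P z → Q z → length (filter P? xs) < length (filter Q? xs)
  length-filter-mono-< (z ∷ xs) P⇒Q (here refl) ¬p q
    rewrite filter-reject P? {xs = xs} ¬p | filter-accept Q? {xs = xs} q =
      s≤s (length-filter-mono xs (P⇒Q ∘ there))
  length-filter-mono-< (z ∷ xs) P⇒Q (there z∈xs) ¬p q
    with ih ← length-filter-mono-< xs (P⇒Q ∘ there) z∈xs ¬p q | P? z | Q? z
  ... | yes _ | yes _ = s≤s ih
  ... | yes p | no ¬q = contradiction (P⇒Q (here refl) p) ¬q
  ... | no _  | yes _ = m≤n⇒m≤1+n ih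
  ... | no _  | no _  = ih

length-filter-map : ∀ {A B : Set} {P : B → Set} (P? : Decidable P) (f : A → B) xs →
  length (filter P? (map f xs)) ≡ length (filter (P? ∘ f) xs)
length-filter-map P? f [] = refl
length-filter-map P? f (z ∷ xs) with ih ← length-filter-map P? f xs | P? (f z)
... | yes _ = cong suc ih
... | no _  = ih

-- Shift-invariant sequences and their chains modulo `k`.

m≡m%n⇒m<n : ∀ {m n} .⦃ _ : NonZero n ⦄ → m % n ≡ m → m < n
m≡m%n⇒m<n {m} {n} eq = subst (_< n) eq (m%n<n m n)

record Periodic (n k : ℕ) (x : ℕ → ℕ) : Set where
  field
    injective : ∀ {p q} → p < n → q < n → x p ≡ x q → p ≡ q
    shift : ∀ {a b} → a ℕ.+ k < n → b ℕ.+ k < n → x a < x b → x (a ℕ.+ k) < x (b ℕ.+ k)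

module _ {n k : ℕ} ⦃ _ : NonZero k ⦄ where

  chain-rec : (P : ℕ → Set) → (∀ {p} → p < k → P p) → (∀ {a} → P a → P (a ℕ.+ k)) → ∀ p → P p
  chain-rec P base step = <-rec P go
    where
    go : ∀ p → (∀ {q} → q < p → P q) → P p
    go p rec with p <? k
    ... | yes p<k = base p<k
    ... | no p≮k  = subst P (m∸n+n≡m (≮⇒≥ p≮k))
            (step (rec (∸-monoʳ-< (ℕ.>-nonZero⁻¹ k) (≮⇒≥ p≮k))))

  head-shift : ∀ a → (a ℕ.+ k) % k ≡ a % k
  head-shift a = [m+n]%n≡m%n a k

  head-small : ∀ {p} → p < k → p % k ≡ p
  head-small = m<n⇒m%n≡m

  head<n : ∀ {p} → p < n → p % k < n
  head<n {p} = ≤-<-trans (m%n≤m p k)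

  pred<n : ∀ {a} → a ℕ.+ k < n → a < n
  pred<n {a} = ≤-<-trans (m≤m+n a k)

  module Chains {x : ℕ → ℕ} (per : Periodic n k x) where
    open Periodic per

    unshift : ∀ {a b} → a ℕ.+ k < n → b ℕ.+ k < n → x (a ℕ.+ k) < x (b ℕ.+ k) → x a < x b
    unshift {a} {b} a<n b<n lt with <-cmp (x a) (x b)
    ... | tri< a<b _ _ = a<b
    ... | tri> _ _ b<a = contradiction lt (<-asym (shift b<n a<n b<a))
    ... | tri≈ _ eq _ with refl ← injective (pred<n a<n) (pred<n b<n) eq = contradiction lt (<-irrefl refl)

    RiseAcross FallAcross : ℕ → ℕ → Set
    RiseAcross c p = p < n → x (p % k) ≤ c → c < x p →
      ∃ λ a → a % k ≡ p % k × a ℕ.+ k < n × x a ≤ c × c < x (a ℕ.+ k)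
    FallAcross c p = p < n → x p ≤ c → c < x (p % k) →
      ∃ λ a → a % k ≡ p % k × a ℕ.+ k < n × x (a ℕ.+ k) ≤ c × c < x a

    -- A discrete intermediate value argument: going back from `p` towards its head, the first step
    -- found to start at or below `c` is the crossing.
    rise-across : ∀ c p → RiseAcross c p
    rise-across c = chain-rec (RiseAcross c) base step
      where
      base : ∀ {p} → p < k → RiseAcross c p
      base p<k p<n h≤c c<p = contradiction (subst (λ i → x i ≤ c) (head-small p<k) h≤c) (<⇒≱ c<p)
      step : ∀ {a} → RiseAcross c a → RiseAcross c (a ℕ.+ k)
      step {a} rec p<n h≤c c<p rewrite head-shift a with x a ≤? c
      ... | yes a≤c = a , refl , p<n , a≤c , c<p
      ... | no a≰c  = rec (pred<n p<n) h≤c (≰⇒> a≰c)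

    fall-across : ∀ c p → FallAcross c p
    fall-across c = chain-rec (FallAcross c) base step
      where
      base : ∀ {p} → p < k → FallAcross c p
      base p<k p<n p≤c c<h = contradiction p≤c (<⇒≱ (subst (λ i → c < x i) (head-small p<k) c<h))
      step : ∀ {a} → FallAcross c a → FallAcross c (a ℕ.+ k)
      step {a} rec p<n p≤c c<h rewrite head-shift a with x a ≤? c
      ... | yes a≤c = rec (pred<n p<n) a≤c c<h
      ... | no a≰c  = a , refl , p<n , p≤c , ≰⇒> a≰c

    -- Otherwise x a ≤ c < x b with x (b + k) ≤ c < x (a + k), against shift invariance.
    no-opposite-crossings : ∀ {c p q} → p < n → q < n →
      x (p % k) ≤ c → c < x p → x q ≤ c → c < x (q % k) → ⊥
    no-opposite-crossings {c} {p} {q} p<n q<n hp≤c c<p q≤c c<hq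
      with a , _ , a<n , a≤c , c<a′ ← rise-across c p p<n hp≤c c<p
         | b , _ , b<n , b′≤c , c<b ← fall-across c q q<n q≤c c<hq =
        <-asym (<-≤-trans (shift a<n b<n (≤-<-trans a≤c c<b)) b′≤c) c<a′

    Rising Falling : ℕ → Set
    Rising p = x (p % k) < x p
    Falling p = x p < x (p % k)

    -- `unshift` carries the rise of a step to the step before it, down to the first step of the
    -- chain. Together with `fall-first` this makes every chain monotone.
    rise-first : ∀ a → a ℕ.+ k < n → x a < x (a ℕ.+ k) → x (a % k) < x (a % k ℕ.+ k)
    rise-first = chain-rec _ (λ a<k _ lt → subst (λ i → x i < x (i ℕ.+ k)) (sym (head-small a<k)) lt)
      λ {a} rec a<n lt → subst (λ i → x i < x (i ℕ.+ k)) (sym (head-shift a))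
        (rec (pred<n a<n) (unshift (pred<n a<n) a<n lt))

    fall-first : ∀ a → a ℕ.+ k < n → x (a ℕ.+ k) < x a → x (a % k ℕ.+ k) < x (a % k)
    fall-first = chain-rec _ (λ a<k _ lt → subst (λ i → x (i ℕ.+ k) < x i) (sym (head-small a<k)) lt)
      λ {a} rec a<n lt → subst (λ i → x (i ℕ.+ k) < x i) (sym (head-shift a))
        (rec (pred<n a<n) (unshift a<n (pred<n a<n) lt))

    -- Crossing the level of the head itself exhibits some rising step, and its rise is carried to
    -- the first one.
    rising⇒rise-first : ∀ {p} → p < n → Rising p → x (p % k) < x (p % k ℕ.+ k)
    rising⇒rise-first {p} p<n rise
      with a , eq , a<n , a≤ , <a ← rise-across _ p p<n ≤-refl rise =
        subst (λ i → x i < x (i ℕ.+ k)) eq (rise-first a a<n (≤-<-trans a≤ <a))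

    falling⇒fall-first : ∀ {p} → p < n → Falling p → x (p % k ℕ.+ k) < x (p % k)
    falling⇒fall-first {p} p<n fall
      with a , eq , a<n , a≤ , <a ← fall-across _ p p<n ≤-refl fall =
        subst (λ i → x (i ℕ.+ k) < x i) eq (fall-first a a<n (≤-<-trans a≤ <a))

    -- The final alternative serves the later induction on values: the predecessor is either a head,
    -- shared by both sequences, or again rising with a smaller value.
    RisingPred : ℕ → Set
    RisingPred p = p < n → Rising p → ∃ λ a → p ≡ a ℕ.+ k × x a < x p × (a < k ⊎ Rising a)

    rising-pred : ∀ p → RisingPred p
    rising-pred = chain-rec RisingPred base step
      where
      base : ∀ {p} → p < k → RisingPred p
      base p<k _ rise = contradiction rise (<-irrefl (cong x (head-small p<k)))
      step : ∀ {a} → RisingPred a → RisingPred (a ℕ.+ k)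
      step {a} _ p<n rise = a , refl , a<p , tail
        where
        first : x (a % k) < x (a % k ℕ.+ k)
        first = subst (λ i → x i < x (i ℕ.+ k)) (head-shift a) (rising⇒rise-first p<n rise)
        a<p : x a < x (a ℕ.+ k)
        a<p with <-cmp (x a) (x (a ℕ.+ k))
        ... | tri< lt _ _ = lt
        ... | tri≈ _ eq _ = contradiction (injective (pred<n p<n) p<n eq) (<⇒≢ (m<m+n a (ℕ.>-nonZero⁻¹ k)))
        ... | tri> _ _ gt = contradiction (fall-first a p<n gt) (<-asym first)
        tail : a < k ⊎ Rising a
        tail with <-cmp (x (a % k)) (x a)
        ... | tri< lt _ _ = inj₂ lt
        ... | tri≈ _ eq _ = inj₁ (m≡m%n⇒m<n (injective (head<n (pred<n p<n)) (pred<n p<n) eq))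
        ... | tri> _ _ gt = contradiction (falling⇒fall-first (pred<n p<n) gt) (<-asym first)

    no-overlap : ∀ {p q} → p < n → q < n → Rising p → Falling q → x (p % k) ≤ x (q % k) → x q < x p → ⊥
    no-overlap {p} {q} p<n q<n rise fall hp≤hq q<p with m≤n⇒m<n∨m≡n hp≤hq
    -- The level is the larger of `x (p % k)` and `x q`, which lies below both `x p` and
    -- `x (q % k)`.
    ... | inj₁ hp<hq = no-opposite-crossings p<n q<n (m≤m⊔n _ _) (⊔-pres-<m rise q<p) (m≤n⊔m _ _) (⊔-pres-<m hp<hq fall)
    -- Equal head values mean a single chain, whose first step would both rise and fall.
    ... | inj₂ eq = <-asym (rising⇒rise-first p<n rise)
            (subst (λ i → x (i ℕ.+ k) < x i) (sym (injective (head<n p<n) (head<n q<n) eq)) (falling⇒fall-first q<n fall))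

  -- Counting values and heads up to a level.

  count : (ℕ → ℕ) → ℕ → ℕ
  count f c = length (filter (λ p → f p ≤? c) (upTo n))

  count-mono : ∀ {f g : ℕ → ℕ} {c} → (∀ {p} → p < n → f p ≤ c → g p ≤ c) → count f c ≤ count g c
  count-mono f⇒g = length-filter-mono _ _ (upTo n) (f⇒g ∘ ∈-upTo⁻)

  heads : (ℕ → ℕ) → ℕ → ℕ
  heads x p = x (p % k)

  module _ {x : ℕ → ℕ} (per : Periodic n k x) where
    open Periodic per
    open Chains per

    -- A position with value at most `c` and head above `c` would cross against `p`, so every
    -- position counted by value is also counted by head; `p` is counted by head only.
    rising⇒count< : ∀ {c p} → p < n → x (p % k) ≤ c → c < x p → count x c < count (heads x) c
    rising⇒count< {c} {p} p<n hp≤c c<p = length-filter-mono-< _ _ (upTo n)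
      (λ q∈ q≤c → ≮⇒≥ λ c<hq → no-opposite-crossings p<n (∈-upTo⁻ q∈) hp≤c c<p q≤c c<hq)
      (∈-upTo⁺ p<n) (<⇒≱ c<p) hp≤c

    -- No chain starting at or below `c` can rise above it against the fall to `q`. The slack of one
    -- admits a fall that only ends at `suc c` or only starts at `c`; both cases occur below.
    falling⇒count≥ : ∀ {c q} → q < n → Falling q → x q ≤ suc c → c ≤ x (q % k) → count (heads x) c ≤ count x c
    falling⇒count≥ {c} {q} q<n fall q≤1+c c≤hq = count-mono λ {p} p<n hp≤c → ≮⇒≥ λ c<p → impossible p<n hp≤c c<p
      where
      impossible : ∀ {p} → p < n → x (p % k) ≤ c → c < x p → ⊥
      impossible {p} p<n hp≤c c<p with m≤n⇒m<n∨m≡n (≤-trans q≤1+c c<p)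
      ... | inj₁ q<p = no-overlap p<n q<n (≤-<-trans hp≤c c<p) fall (≤-trans hp≤c c≤hq) q<p
      ... | inj₂ eq with refl ← injective q<n p<n eq = <-asym fall (≤-<-trans hp≤c c<p)

  -- Agreement of two sequences on their rising chains.

  record Similar (x y : ℕ → ℕ) : Set where
    field
      periodicˡ : Periodic n k x
      periodicʳ : Periodic n k y
      same-heads : ∀ {i} → i < k → x i ≡ y i
      same-values : applyUpTo x n ↭ applyUpTo y n

  open Similar

  similar-sym : ∀ {x y} → Similar x y → Similar y x
  similar-sym s = record
    { periodicˡ = periodicʳ s ; periodicʳ = periodicˡ s
    ; same-heads = λ i<k → sym (same-heads s i<k) ; same-values = ↭-sym (same-values s) }

  count≡ : ∀ {x y} → Similar x y → ∀ c → count x c ≡ count y c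
  count≡ {x} {y} s c = begin
    count x c                                      ≡⟨ length-filter-map (_≤? c) x (upTo n) ⟨
    length (filter (_≤? c) (map x (upTo n)))       ≡⟨ cong (length ∘ filter (_≤? c)) (map-upTo x n) ⟩
    length (filter (_≤? c) (applyUpTo x n))        ≡⟨ ↭-length (filter-↭ (_≤? c) (same-values s)) ⟩
    length (filter (_≤? c) (applyUpTo y n))        ≡⟨ cong (length ∘ filter (_≤? c)) (map-upTo y n) ⟨
    length (filter (_≤? c) (map y (upTo n)))       ≡⟨ length-filter-map (_≤? c) y (upTo n) ⟩
    count y c                                      ∎
    where open ≡-Reasoning

  -- The rise in `x` puts the head count above the value count at `c`, the fall in `y` forbids this,
  -- and both counts are common to `x` and `y`.
  no-direction-change : ∀ {x y} → Similar x y → ∀ {c p q} → p < n → q < n →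
    x (p % k) ≤ c → c < x p → y q < y (q % k) → y q ≤ suc c → c ≤ y (q % k) → ⊥
  no-direction-change {x} {y} s {c} {p} p<n q<n hp≤c c<p fall q≤1+c c≤hq = <-irrefl refl (begin-strict
    count x c         <⟨ rising⇒count< (periodicˡ s) p<n hp≤c c<p ⟩
    count (heads x) c ≤⟨ count-mono (λ {r} _ → subst (_≤ c) (same-heads s (m%n<n r k))) ⟩
    count (heads y) c ≤⟨ falling⇒count≥ (periodicʳ s) q<n fall q≤1+c c≤hq ⟩
    count y c         ≡⟨ count≡ s c ⟨
    count x c         ∎)
    where open ≤-Reasoning

  -- Indexed by the value, on which the induction runs, and quantified over the pair, so that the
  -- hypothesis also applies with the two sequences exchanged.
  RisingAgree : ℕ → Set
  RisingAgree v = ∀ {x y} → Similar x y → ∀ {p} → p < n → x p ≡ v → x (p % k) < x p → y p ≡ v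

  module _ {v} (rec : ∀ {u} → u < v → RisingAgree u) where

    -- Were `y p` smaller, a rise in `y` would fall under the induction hypothesis for the exchanged
    -- pair, a head would be shared, and a fall would change direction at the level of the common
    -- head.
    rising-not-below : ∀ {x y} → Similar x y → ∀ {p} → p < n → x p ≡ v → x (p % k) < x p → ¬ (y p < v)
    rising-not-below {x} {y} s {p} p<n refl rise yp<v with <-cmp (y (p % k)) (y p)
    ... | tri< lt _ _ = <⇒≢ yp<v (sym (rec yp<v (similar-sym s) p<n refl lt))
    ... | tri≈ _ eq _ = <⇒≢ yp<v (sym (same-heads s (m≡m%n⇒m<n (Periodic.injective (periodicʳ s) (head<n p<n) p<n eq))))
    ... | tri> _ _ gt = no-direction-change s p<n p<n ≤-refl rise gt
            (≤-trans (<⇒≤ gt) (≤-trans (≤-reflexive (sym h)) (n≤1+n _))) (≤-reflexive h)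
      where
      h : x (p % k) ≡ y (p % k)
      h = same-heads s (m%n<n p k)

    pred-agree : ∀ {x y} → Similar x y → ∀ {p} → p < n → x p ≡ v → x (p % k) < x p →
      ∃ λ a → p ≡ a ℕ.+ k × x a ≡ y a
    pred-agree s p<n refl rise with Chains.rising-pred (periodicˡ s) _ p<n rise
    ... | a , refl , a<p , inj₁ a<k = a , refl , same-heads s a<k
    ... | a , refl , a<p , inj₂ ra  = a , refl , sym (rec a<p s (pred<n p<n) refl ra)

    -- Let `q` carry the value `v` in `y`. If `q` rises there, the predecessors of `p` and `q` have
    -- the same values in both sequences, and shifting keeps their order. Distinct predecessors
    -- would then give `y p < v` or `x q < v`, which `rising-not-below` excludes, so `p` and `q`
    -- coincide.
    rising-agree-step : RisingAgree v
    rising-agree-step {x} {y} s {p} p<n eq rise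
      with q , q<n , v≡yq ← ∈-applyUpTo⁻ y (∈-resp-↭ (same-values s) (subst (_∈ applyUpTo x n) eq (∈-applyUpTo⁺ x p<n)))
      with <-cmp (y (q % k)) (y q)
    ... | tri≈ _ h≡ _ = trans (cong y (sym q≡p)) (sym v≡yq)
      where
      q<k : q < k
      q<k = m≡m%n⇒m<n (Periodic.injective (periodicʳ s) (head<n q<n) q<n h≡)
      q≡p : q ≡ p
      q≡p = Periodic.injective (periodicˡ s) q<n p<n (trans (same-heads s q<k) (trans (sym v≡yq) (sym eq)))
    ... | tri> _ _ fall = ⊥-elim (below v v≡yq eq)
      where
      below : ∀ v → v ≡ y q → x p ≡ v → ⊥
      below zero v≡ xp≡ = n≮0 (subst (x (p % k) <_) xp≡ rise)
      -- At the level `c` just under the value, the chain to `p` crosses upwards in `x`, while `q`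
      -- falls in `y` to exactly `suc c`.
      below (suc c) v≡ xp≡ = no-direction-change s p<n q<n (ℕ.s≤s⁻¹ (subst (x (p % k) <_) xp≡ rise))
        (≤-reflexive (sym xp≡)) fall (≤-reflexive (sym v≡)) (<⇒≤ (<-trans (≤-reflexive v≡) fall))
    ... | tri< yrise _ _
      with a , refl , xa≡ya ← pred-agree s p<n eq rise
         | b , refl , yb≡xb ← pred-agree (similar-sym s) q<n (sym v≡yq) yrise
      with <-cmp (x a) (x b)
    ...   | tri≈ _ e _ with refl ← Periodic.injective (periodicˡ s) (pred<n p<n) (pred<n q<n) e = sym v≡yq
    ...   | tri< lt _ _ = ⊥-elim (rising-not-below s p<n eq rise
              (subst (_ <_) (sym v≡yq) (Periodic.shift (periodicʳ s) p<n q<n (subst₂ _<_ xa≡ya (sym yb≡xb) lt))))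
    ...   | tri> _ _ gt = ⊥-elim (rising-not-below (similar-sym s) q<n (sym v≡yq) yrise
              (subst (_ <_) eq (Periodic.shift (periodicˡ s) q<n p<n gt)))

  rising-agree : ∀ v → RisingAgree v
  rising-agree = <-rec _ λ v rec → rising-agree-step rec

  -- Falling chains, by complementing the values.

  module _ {m : ℕ} where

    complement-periodic : ∀ {x} → (∀ {p} → p < n → x p ≤ m) → Periodic n k x → Periodic n k (λ p → m ∸ x p)
    complement-periodic x≤m per = record
      { injective = λ p<n q<n eq → injective p<n q<n (∸-cancelˡ-≡ (x≤m p<n) (x≤m q<n) eq)
      ; shift = λ a<n b<n lt → ∸-monoʳ-< (shift b<n a<n (∸-cancelʳ-< lt)) (x≤m a<n)
      }
      where open Periodic per

    complement-similar : ∀ {x y} → (∀ {p} → p < n → x p ≤ m) → (∀ {p} → p < n → y p ≤ m) →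
      Similar x y → Similar (λ p → m ∸ x p) (λ p → m ∸ y p)
    complement-similar {x} {y} x≤m y≤m s = record
      { periodicˡ = complement-periodic x≤m (periodicˡ s)
      ; periodicʳ = complement-periodic y≤m (periodicʳ s)
      ; same-heads = λ i<k → cong (m ∸_) (same-heads s i<k)
      ; same-values = subst₂ _↭_ (map-applyUpTo x (m ∸_) n) (map-applyUpTo y (m ∸_) n) (map⁺ (m ∸_) (same-values s))
      }

    -- Complementing in `m` turns falling positions into rising ones; the bounds by `m` allow the
    -- truncated subtraction to be cancelled.
    similar⇒≡ : ∀ {x y} → (∀ {p} → p < n → x p ≤ m) → (∀ {p} → p < n → y p ≤ m) →
      Similar x y → ∀ {p} → p < n → x p ≡ y p
    similar⇒≡ {x} {y} x≤m y≤m s {p} p<n with <-cmp (x (p % k)) (x p)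
    ... | tri< lt _ _ = sym (rising-agree _ s p<n refl lt)
    ... | tri≈ _ eq _ = same-heads s (m≡m%n⇒m<n (Periodic.injective (periodicˡ s) (head<n p<n) p<n eq))
    ... | tri> _ _ gt = ∸-cancelˡ-≡ (x≤m p<n) (y≤m p<n)
      (sym (rising-agree _ (complement-similar x≤m y≤m s) p<n refl (∸-monoʳ-< gt (x≤m (head<n p<n)))))

-- Lists as functions of a position counted from 0.

nth : List ℕ → ℕ → ℕ
-- This default lets `nth-take` and `nth-drop` hold without a bound by the length of the list.
nth [] i = 0
nth (a ∷ as) zero = a
nth (a ∷ as) (suc i) = nth as i

applyUpTo-nth : ∀ as → applyUpTo (nth as) (length as) ≡ as
applyUpTo-nth [] = refl
applyUpTo-nth (a ∷ as) = cong (a ∷_) (applyUpTo-nth as)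

nth-map : ∀ (f : ℕ → ℕ) as {i} → i < length as → nth (map f as) i ≡ f (nth as i)
nth-map f (a ∷ as) {zero} _ = refl
nth-map f (a ∷ as) {suc i} (s≤s i<) = nth-map f as i<

nth-take : ∀ m as {i} → i < m → nth (take m as) i ≡ nth as i
nth-take (suc m) [] _ = refl
nth-take (suc m) (a ∷ as) {zero} _ = refl
nth-take (suc m) (a ∷ as) {suc i} (s≤s i<m) = nth-take m as i<m

nth-drop : ∀ m as i → nth (drop m as) i ≡ nth as (m ℕ.+ i)
nth-drop zero as i = refl
nth-drop (suc m) [] i = refl
nth-drop (suc m) (a ∷ as) i = nth-drop m as i

nth-∈ : ∀ as {i} → i < length as → nth as i ∈ as
nth-∈ (a ∷ as) {zero} _ = here refl
nth-∈ (a ∷ as) {suc i} (s≤s i<) = there (nth-∈ as i<)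

nth-injective : ∀ {as i j} → Unique as → i < length as → j < length as → nth as i ≡ nth as j → i ≡ j
nth-injective {a ∷ as} {zero} {zero} _ _ _ _ = refl
nth-injective {a ∷ as} {zero} {suc j} (a∉ ∷ _) _ (s≤s j<) eq = contradiction eq (All.lookup a∉ (nth-∈ as j<))
nth-injective {a ∷ as} {suc i} {zero} (a∉ ∷ _) (s≤s i<) _ eq = contradiction (sym eq) (All.lookup a∉ (nth-∈ as i<))
nth-injective {a ∷ as} {suc i} {suc j} (_ ∷ u) (s≤s i<) (s≤s j<) eq = cong suc (nth-injective u i< j< eq)

-- Standardization and closed walks.

module _ (cs : List ℕ) {i j : ℕ} (i< : i < length cs) (j< : j < length cs) where

  -- Ranks count smaller entries: all that lies below entry `i` lies below entry `j`, and entry `i`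
  -- itself is counted only for `j`.
  st-preserves-< : nth cs i < nth cs j → nth (st cs) i < nth (st cs) j
  st-preserves-< lt = subst₂ _<_ (sym (nth-map _ cs i<)) (sym (nth-map _ cs j<))
    (s≤s (length-filter-mono-< (_<? nth cs i) (_<? nth cs j) cs (λ _ z< → <-trans z< lt) (nth-∈ cs i<) (<-irrefl refl) lt))

  st-reflects-< : nth (st cs) i < nth (st cs) j → nth cs i < nth cs j
  st-reflects-< lt = ≰⇒> λ ge → <⇒≱ (subst₂ _<_ (nth-map _ cs i<) (nth-map _ cs j<) lt)
    (s≤s (length-filter-mono (_<? nth cs j) (_<? nth cs i) cs (λ _ z< → <-≤-trans z< ge)))

module _ {n : ℕ} where

  perm-length : ∀ {x} → IsPerm n x → length x ≡ n
  perm-length perm = trans (↭-length perm) (trans (length-map suc (upTo n)) (length-upTo n))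

  perm-values : ∀ {x} → IsPerm n x → applyUpTo (nth x) n ≡ x
  perm-values {x} perm = trans (cong (applyUpTo (nth x)) (sym (perm-length perm))) (applyUpTo-nth x)

  perm-unique : ∀ {x} → IsPerm n x → Unique x
  perm-unique perm = Unique-resp-↭ (setoid ℕ) (↭⇒↭ₛ (↭-sym perm)) (Unique.map⁺ suc-injective (Unique.upTo⁺ n))

  perm-bounded : ∀ {x} → IsPerm n x → ∀ {p} → p < n → nth x p ≤ n
  perm-bounded {x} perm p<n
    with _ , i∈ , eq ← ∈-map⁻ suc (∈-resp-↭ perm (nth-∈ x (subst (_ <_) (sym (perm-length perm)) p<n))) =
      subst (_≤ n) (sym eq) (∈-upTo⁻ i∈)

  -- For permutations this is equality of the standardizations of `x` without its first `d` entries
  -- and `w` without its last `d`.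
  Overlap : ℕ → List ℕ → List ℕ → Set
  Overlap d x w = ∀ {i j} → d ℕ.+ i < n → d ℕ.+ j < n → nth w i < nth w j → nth x (d ℕ.+ i) < nth x (d ℕ.+ j)

  overlap-refl : ∀ {x} → Overlap 0 x x
  overlap-refl _ _ lt = lt

  overlap-trans : ∀ {d e x w z} → Overlap d x w → Overlap e w z → Overlap (d ℕ.+ e) x z
  overlap-trans {d} {e} {x} xw wz {i} {j} i< j< lt =
    subst₂ (λ a b → nth x a < nth x b) (sym (+-assoc d e i)) (sym (+-assoc d e j))
      (xw i<′ j<′ (wz (≤-<-trans (m≤n+m _ d) i<′) (≤-<-trans (m≤n+m _ d) j<′) lt))
    where
    i<′ = subst (_< n) (+-assoc d e i) i<
    j<′ = subst (_< n) (+-assoc d e j) j<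

  -- `x` and `w` standardize two windows of `c` that share all but its first and last entries, so an
  -- order in `w` passes to `c` and on to `x`.
  edge-overlap : ∀ {x w} → Edge n x w → Overlap 1 x w
  edge-overlap (c , perm , refl , refl) {i} {j} i< j< lt =
    st-preserves-< (take n c) (in-take i<) (in-take j<)
      (subst₂ _<_ (middle i<) (middle j<) (st-reflects-< (drop 1 c) (in-drop i<) (in-drop j<) lt))
    where
    length-c : length c ≡ suc n
    length-c = trans (↭-length perm) (trans (length-map suc (upTo (suc n))) (length-upTo (suc n)))
    in-take : ∀ {i} → i < n → i < length (take n c)
    in-take {i} i<n = subst (i <_) (sym (trans (length-take n c) (m≤n⇒m⊓n≡m (subst (n ≤_) (sym length-c) (n≤1+n n))))) i<n
    in-drop : ∀ {i} → suc i < n → i < length (drop 1 c)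
    in-drop {i} i<n = subst (i <_) (sym (trans (length-drop 1 c) (cong (_∸ 1) length-c))) (<⇒≤ i<n)
    middle : ∀ {i} → suc i < n → nth (drop 1 c) i ≡ nth (take n c) (suc i)
    middle {i} i<n = trans (nth-drop 1 c i) (sym (nth-take n c i<n))

  module _ {k : ℕ} {v : Fin k → List ℕ} (walk : ClosedWalk n k v) where

    path-overlap : ∀ d (i j : Fin k) → toℕ i ℕ.+ d ≡ toℕ j → Overlap d (v i) (v j)
    path-overlap zero i j eq with refl ← toℕ-injective (trans (sym (+-identityʳ _)) eq) = overlap-refl {v i}
    path-overlap (suc d) i j eq = overlap-trans {1} {d} {v i} {v i′} {v j}
      (edge-overlap (proj₁ (proj₂ walk) i i′ (sym (toℕ-fromℕ< i′<k))))
      (path-overlap d i′ j (trans (cong (ℕ._+ d) (toℕ-fromℕ< i′<k)) eq′))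
      where
      eq′ : suc (toℕ i) ℕ.+ d ≡ toℕ j
      eq′ = trans (sym (+-suc (toℕ i) d)) eq
      i′<k : suc (toℕ i) < k
      i′<k = ≤-<-trans (m+n≤o⇒m≤o _ (≤-reflexive eq′)) (toℕ<n j)
      i′ : Fin k
      i′ = fromℕ< i′<k

  -- From `v i` to the last vertex, over the closing edge, then from the first vertex back to `v i`:
  -- the shifts by one add up to `k`.
  closed-walk-overlap : ∀ {k v} → ClosedWalk n k v → ∀ i → Overlap k (v i) (v i)
  closed-walk-overlap {suc k} {v} walk i = subst (λ d → Overlap d (v i) (v i)) total
    (overlap-trans {d₁} {suc (toℕ i)} {v i} {v last} {v i}
      (path-overlap walk d₁ i last (trans (m+[n∸m]≡n i≤k) (sym (toℕ-fromℕ k))))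
      (overlap-trans {1} {toℕ i} {v last} {v Fin.zero} {v i}
        (edge-overlap (proj₂ (proj₂ walk) last Fin.zero (cong suc (toℕ-fromℕ k)) refl))
        (path-overlap walk (toℕ i) Fin.zero i refl)))
    where
    last : Fin (suc k)
    last = fromℕ k
    i≤k : toℕ i ≤ k
    i≤k = ℕ.s≤s⁻¹ (toℕ<n i)
    d₁ = k ∸ toℕ i
    total : d₁ ℕ.+ suc (toℕ i) ≡ suc k
    total = trans (+-suc d₁ (toℕ i)) (cong suc (m∸n+n≡m i≤k))

  in-closed-walk⇒periodic : ∀ {k x} → InClosedWalk n k x → Periodic n k (nth x)
  in-closed-walk⇒periodic {k} {x} (perm , v , walk , i , refl) = record
    { injective = λ p<n q<n → nth-injective (perm-unique perm) (inside p<n) (inside q<n)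
    ; shift = λ {a} {b} a< b< lt → subst₂ (λ p q → nth x p < nth x q) (+-comm k a) (+-comm k b)
        (closed-walk-overlap walk i (subst (_< n) (+-comm a k) a<) (subst (_< n) (+-comm b k) b<) lt)
    }
    where
    inside : ∀ {p} → p < n → p < length x
    inside = subst (_ <_) (sym (perm-length perm))

-- Determination of a vertex by its first `k` entries.

applyUpTo-cong : ∀ {f g : ℕ → ℕ} n → (∀ {i} → i < n → f i ≡ g i) → applyUpTo f n ≡ applyUpTo g n
applyUpTo-cong zero f≡g = refl
applyUpTo-cong (suc n) f≡g = cong₂ _∷_ (f≡g (s≤s z≤n)) (applyUpTo-cong n (f≡g ∘ s≤s))

in-closed-walk-determined : ∀ {n k x y} ⦃ _ : NonZero k ⦄ → InClosedWalk n k x → InClosedWalk n k y →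
  take k x ≡ take k y → x ≡ y
in-closed-walk-determined {n} {k} {x} {y} wx wy eq = begin
  x                    ≡⟨ perm-values permx ⟨
  applyUpTo (nth x) n  ≡⟨ applyUpTo-cong n (similar⇒≡ (perm-bounded permx) (perm-bounded permy) similar) ⟩
  applyUpTo (nth y) n  ≡⟨ perm-values permy ⟩
  y                    ∎
  where
  open ≡-Reasoning
  permx = proj₁ wx
  permy = proj₁ wy
  similar : Similar (nth x) (nth y)
  similar = record
    { periodicˡ = in-closed-walk⇒periodic wx
    ; periodicʳ = in-closed-walk⇒periodic wy
    ; same-heads = λ {i} i<k → trans (sym (nth-take k x i<k)) (trans (cong (λ as → nth as i) eq) (nth-take k y i<k))
    ; same-values = subst₂ _↭_ (sym (perm-values permx)) (sym (perm-values permy)) (↭-trans permx (↭-sym permy))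
    }

-- Counting tuples of distinct entries.

without : ℕ → List ℕ → List ℕ
without a = filter (λ b → ¬? (b ≟ a))

tuples : ℕ → List ℕ → List (List ℕ)
tuples zero M = [] ∷ []
tuples (suc k) M = concatMap (λ a → map (a ∷_) (tuples k (without a M))) M

∈-tuples : ∀ {t M} → Unique t → All (_∈ M) t → t ∈ tuples (length t) M
∈-tuples [] All.[] = here refl
∈-tuples {a ∷ t} {M} (a∉ ∷ u) (a∈M All.∷ t⊆M) = ∈-concatMap⁺ _
  (Any.map (λ { refl → ∈-map⁺ (a ∷_) (∈-tuples u
    (All.zipWith (λ { (a≢b , b∈M) → ∈-filter⁺ _ b∈M (a≢b ∘ sym) }) (a∉ , t⊆M))) }) a∈M)

length-concatMap-≤ : ∀ {A B : Set} {f : A → List B} {b c} xs →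
  (∀ {a} → a ∈ xs → length (f a) ℕ.* c ≤ b) → length (concatMap f xs) ℕ.* c ≤ length xs ℕ.* b
length-concatMap-≤ [] f≤ = z≤n
length-concatMap-≤ {f = f} {b} {c} (a ∷ xs) f≤ = begin
  length (f a ++ concatMap f xs) ℕ.* c                    ≡⟨ cong (ℕ._* c) (length-++ (f a)) ⟩
  (length (f a) ℕ.+ length (concatMap f xs)) ℕ.* c         ≡⟨ *-distribʳ-+ c (length (f a)) _ ⟩
  length (f a) ℕ.* c ℕ.+ length (concatMap f xs) ℕ.* c     ≤⟨ +-mono-≤ (f≤ (here refl)) (length-concatMap-≤ xs (f≤ ∘ there)) ⟩
  b ℕ.+ length xs ℕ.* b                                   ∎
  where open ≤-Reasoning

-- Choosing an entry lowers `n` and `k` together, so `(n ∸ k) !` stays fixed through the recursion,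
-- and the product form avoids a division.
length-tuples : ∀ k {n} M → length M ≤ n → k ≤ n → length (tuples k M) ℕ.* (n ∸ k) ! ≤ n !
length-tuples zero M _ _ = ≤-reflexive (*-identityˡ _)
length-tuples (suc k) {suc n} M M≤n (s≤s k≤n) = ≤-trans
  (length-concatMap-≤ M λ {a} a∈M → subst (λ l → l ℕ.* (n ∸ k) ! ≤ n !) (sym (length-map (a ∷_) (tuples k (without a M))))
    (length-tuples k (without a M)
      (ℕ.s≤s⁻¹ (≤-trans (filter-notAll (λ b → ¬? (b ≟ a)) M (Any.map (λ { refl ¬a≡a → ¬a≡a refl }) a∈M)) M≤n)) k≤n))
  (*-monoˡ-≤ (n !) M≤n)

lookup-injective : ∀ {A : Set} {xs : List A} → Unique xs → ∀ {i j} → lookup xs i ≡ lookup xs j → i ≡ j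
lookup-injective {xs = _ ∷ _} _ {Fin.zero} {Fin.zero} _ = refl
lookup-injective {xs = _ ∷ xs} (a∉ ∷ _) {Fin.zero} {Fin.suc j} eq = contradiction eq (All.lookup a∉ (∈-lookup j))
lookup-injective {xs = _ ∷ xs} (a∉ ∷ _) {Fin.suc i} {Fin.zero} eq = contradiction (sym eq) (All.lookup a∉ (∈-lookup i))
lookup-injective {xs = _ ∷ _} (_ ∷ u) {Fin.suc i} {Fin.suc j} eq = cong Fin.suc (lookup-injective u eq)

-- Sending each index in `xs` to the index of its image in `ys` is an injection of finite index
-- sets.
length-≤-by-injection : ∀ {A B : Set} {xs : List A} {ys : List B} (f : A → B) → Unique xs →
  (∀ {a} → a ∈ xs → f a ∈ ys) → (∀ {a b} → a ∈ xs → b ∈ xs → f a ≡ f b → a ≡ b) → length xs ≤ length ys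
length-≤-by-injection {B = B} {xs} {ys} f u f∈ inj = injective⇒≤ {f = λ i → Any.index (image i)} λ {i} {j} eq →
  lookup-injective u (inj (∈-lookup i) (∈-lookup j) (index-injective (setoid B) (image i) (image j) eq))
  where
  image : ∀ i → f (lookup xs i) ∈ ys
  image i = f∈ (∈-lookup i)

closed-walk-vertices-≤ : ∀ {n k} ⦃ _ : NonZero k ⦄ → k ≤ n → ∀ {S} → Unique S → All (InClosedWalk n k) S →
  length S ℕ.* (n ∸ k) ! ≤ n !
closed-walk-vertices-≤ {n} {k} k≤n {S} u walks = ≤-trans
  (*-monoˡ-≤ ((n ∸ k) !) (length-≤-by-injection (take k) u head∈
    (λ x∈ y∈ → in-closed-walk-determined (All.lookup walks x∈) (All.lookup walks y∈))))
  (length-tuples k [1‥ n ] (≤-reflexive (trans (length-map suc (upTo n)) (length-upTo n))) k≤n)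
  where
  head∈ : ∀ {x} → x ∈ S → take k x ∈ tuples k [1‥ n ]
  head∈ {x} x∈ = subst (λ l → take k x ∈ tuples l [1‥ n ])
    (trans (length-take k x) (m≤n⇒m⊓n≡m (subst (k ≤_) (sym (perm-length perm)) k≤n)))
    (∈-tuples (Unique.take⁺ k (perm-unique perm)) (All.take⁺ k (All.tabulate (∈-resp-↭ perm))))
    where perm = proj₁ (All.lookup walks x∈)

-- Comparison with the claimed bound.

ceil/4-≤ : ∀ m → ⌈ m /4⌉ ≤ m
ceil/4-≤ m = ℕ.s≤s⁻¹ (m<n*o⇒m/o<n (begin-strict
  m ℕ.+ 3        ≡⟨ +-comm m 3 ⟩
  3 ℕ.+ m        <⟨ +-monoʳ-≤ 4 (m≤m*n m 4) ⟩
  4 ℕ.+ m ℕ.* 4  ∎))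
  where open ≤-Reasoning

-- `c` stands for the ceiling and is replaced by `n ∸ 1`. With `n` as `7 + s` and `k` as `3 + j`,
-- the surplus is a polynomial in `s` and `j` with nonnegative coefficients.
ℕ-bound : ∀ {n k c} → 7 ≤ n → 3 ≤ k → c ≤ n ∸ 1 →
  2 ℕ.* n ℕ.* (n ∸ 1) ℕ.+ (9 ℕ.+ 2 ℕ.* (n ∸ 1) ℕ.* c)
    ≤ (2 ℕ.* n ℕ.+ 1) ℕ.* (n ℕ.+ 1) ℕ.* (n ∸ 1) ℕ.+ 2 ℕ.* k ℕ.+ n
ℕ-bound {c = c} 7≤n 3≤k c≤n-1
  with s , refl ← m≤n⇒∃[o]m+o≡n 7≤n | j , refl ← m≤n⇒∃[o]m+o≡n 3≤k = begin
    2 ℕ.* (7 ℕ.+ s) ℕ.* (6 ℕ.+ s) ℕ.+ (9 ℕ.+ 2 ℕ.* (6 ℕ.+ s) ℕ.* c)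
      ≤⟨ +-monoʳ-≤ (2 ℕ.* (7 ℕ.+ s) ℕ.* (6 ℕ.+ s)) (+-monoʳ-≤ 9 (*-monoʳ-≤ (2 ℕ.* (6 ℕ.+ s)) c≤n-1)) ⟩
    2 ℕ.* (7 ℕ.+ s) ℕ.* (6 ℕ.+ s) ℕ.+ (9 ℕ.+ 2 ℕ.* (6 ℕ.+ s) ℕ.* (6 ℕ.+ s))
      ≤⟨ m≤m+n _ _ ⟩
    2 ℕ.* (7 ℕ.+ s) ℕ.* (6 ℕ.+ s) ℕ.+ (9 ℕ.+ 2 ℕ.* (6 ℕ.+ s) ℕ.* (6 ℕ.+ s))
      ℕ.+ ((6 ℕ.+ s) ℕ.* (94 ℕ.+ 27 ℕ.* s ℕ.+ 2 ℕ.* s ℕ.* s) ℕ.+ 2 ℕ.* j ℕ.+ 4 ℕ.+ s)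
      ≡⟨ identity s j ⟩
    (2 ℕ.* (7 ℕ.+ s) ℕ.+ 1) ℕ.* (7 ℕ.+ s ℕ.+ 1) ℕ.* (6 ℕ.+ s) ℕ.+ 2 ℕ.* (3 ℕ.+ j) ℕ.+ (7 ℕ.+ s) ∎
  where
  open ≤-Reasoning
  identity : ∀ s j →
    2 ℕ.* (7 ℕ.+ s) ℕ.* (6 ℕ.+ s) ℕ.+ (9 ℕ.+ 2 ℕ.* (6 ℕ.+ s) ℕ.* (6 ℕ.+ s))
      ℕ.+ ((6 ℕ.+ s) ℕ.* (94 ℕ.+ 27 ℕ.* s ℕ.+ 2 ℕ.* s ℕ.* s) ℕ.+ 2 ℕ.* j ℕ.+ 4 ℕ.+ s)
    ≡ (2 ℕ.* (7 ℕ.+ s) ℕ.+ 1) ℕ.* (7 ℕ.+ s ℕ.+ 1) ℕ.* (6 ℕ.+ s) ℕ.+ 2 ℕ.* (3 ℕ.+ j) ℕ.+ (7 ℕ.+ s)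
  identity = ℕ-solve-∀

-- Gathering the subtracted terms, where 5 and 4 merge into 9, turns the integer expression into a
-- difference of two naturals.
ℤ-difference : ∀ a b n′ k n c →
  + a * + b * + n′ + + 2 * + k + (+ n - + 5) - + 4 - + 2 * + n′ * + c
    ≡ + (a ℕ.* b ℕ.* n′ ℕ.+ 2 ℕ.* k ℕ.+ n) - + (9 ℕ.+ 2 ℕ.* n′ ℕ.* c)
ℤ-difference a b n′ k n c = begin
  + a * + b * + n′ + + 2 * + k + (+ n - + 5) - + 4 - + 2 * + n′ * + c
    ≡⟨ regroup (+ a * + b * + n′ + + 2 * + k) (+ n) (+ 2 * + n′ * + c) ⟩
  + a * + b * + n′ + + 2 * + k + + n - (+ 9 + + 2 * + n′ * + c)
    ≡⟨ cong₂ (λ i j → i + + n - (+ 9 + j)) (cong₂ _+_ (pos-*₃ a b n′) (sym (ℤ.pos-* 2 k))) (pos-*₃ 2 n′ c) ⟩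
  + (a ℕ.* b ℕ.* n′ ℕ.+ 2 ℕ.* k ℕ.+ n) - + (9 ℕ.+ 2 ℕ.* n′ ℕ.* c) ∎
  where
  open ≡-Reasoning
  regroup : ∀ i j l → i + (j - + 5) - + 4 - l ≡ i + j - (+ 9 + l)
  regroup = ℤ-solve-∀
  pos-*₃ : ∀ l m o → + l * + m * + o ≡ + (l ℕ.* m ℕ.* o)
  pos-*₃ l m o = trans (cong (_* + o) (sym (ℤ.pos-* l m))) (sym (ℤ.pos-* (l ℕ.* m) o))

theorem5p2 : (n k : ℕ) → 3 ≤ k → k ≤ n ∸ 1 → 2 Data.Nat.* k < n → n % 2 ≡ 1 →
    (S : List (List ℕ)) → Unique S → All (InClosedWalk n k) S →
    + (2 Data.Nat.* ((n ∸ k) !) Data.Nat.* length S)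
    ≤ℤ + ((n ∸ 2) !) * ((+ (2 Data.Nat.* n Data.Nat.+ 1)) * + (n Data.Nat.+ 1) * + (n ∸ 1)
    + + 2 * + k + (+ n - + 5) - + 4 - + 2 * + (n ∸ 1) * + ⌈ n ∸ 1 /4⌉)
theorem5p2 n k 3≤k k≤n-1 2k<n _ S u walks = subst (+ (2 ℕ.* ((n ∸ k) !) ℕ.* length S) ≤ℤ_) (sym rhs) (ℤ.+≤+ bound)
  where
  -- The added and the subtracted terms of twice the bracket.
  A B : ℕ
  A = (2 ℕ.* n ℕ.+ 1) ℕ.* (n ℕ.+ 1) ℕ.* (n ∸ 1) ℕ.+ 2 ℕ.* k ℕ.+ n
  B = 9 ℕ.+ 2 ℕ.* (n ∸ 1) ℕ.* ⌈ n ∸ 1 /4⌉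
  7≤n : 7 ≤ n
  7≤n = ≤-trans (s≤s (*-monoʳ-≤ 2 3≤k)) 2k<n
  A-B : 2 ℕ.* n ℕ.* (n ∸ 1) ℕ.+ B ≤ A
  A-B = ℕ-bound 7≤n 3≤k (ceil/4-≤ (n ∸ 1))
  rhs : + ((n ∸ 2) !) * ((+ (2 ℕ.* n ℕ.+ 1)) * + (n ℕ.+ 1) * + (n ∸ 1)
      + + 2 * + k + (+ n - + 5) - + 4 - + 2 * + (n ∸ 1) * + ⌈ n ∸ 1 /4⌉) ≡ + ((n ∸ 2) ! ℕ.* (A ∸ B))
  rhs = trans (cong (+ ((n ∸ 2) !) *_)
    (trans (ℤ-difference (2 ℕ.* n ℕ.+ 1) (n ℕ.+ 1) (n ∸ 1) k n ⌈ n ∸ 1 /4⌉)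
    -- `B ≤ A` follows from `A-B`, so the integer difference equals the truncated one.
    (trans (ℤ.m-n≡m⊖n A B) (ℤ.⊖-≥ (≤-trans (m≤n+m B _) A-B)))))
    (sym (ℤ.pos-* ((n ∸ 2) !) (A ∸ B)))
  -- Splitting off the two top factors of `n !` leaves the common factor `(n ∸ 2) !` and reduces the
  -- claim to `2 * n * (n ∸ 1) ≤ A ∸ B`.
  factorial : ∀ {n} → 2 ≤ n → 2 ℕ.* n ! ≡ (n ∸ 2) ! ℕ.* (2 ℕ.* n ℕ.* (n ∸ 1))
  factorial {suc zero} (s≤s ())
  factorial {suc (suc m)} _ = rearrange (m !) m
    where
    rearrange : ∀ f m → 2 ℕ.* (suc (suc m) ℕ.* (suc m ℕ.* f)) ≡ f ℕ.* (2 ℕ.* suc (suc m) ℕ.* suc m)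
    rearrange = ℕ-solve-∀
  vertices : length S ℕ.* (n ∸ k) ! ≤ n !
  vertices = closed-walk-vertices-≤ ⦃ ℕ.>-nonZero (<-≤-trans (s≤s z≤n) 3≤k) ⦄ (≤-trans k≤n-1 (m∸n≤m n 1)) u walks
  bound : 2 ℕ.* ((n ∸ k) !) ℕ.* length S ≤ (n ∸ 2) ! ℕ.* (A ∸ B)
  bound = begin
    2 ℕ.* ((n ∸ k) !) ℕ.* length S          ≡⟨ *-assoc 2 ((n ∸ k) !) (length S) ⟩
    2 ℕ.* ((n ∸ k) ! ℕ.* length S)          ≡⟨ cong (2 ℕ.*_) (*-comm ((n ∸ k) !) _) ⟩
    2 ℕ.* (length S ℕ.* (n ∸ k) !)          ≤⟨ *-monoʳ-≤ 2 vertices ⟩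
    2 ℕ.* n !                               ≡⟨ factorial (≤-trans (s≤s (s≤s z≤n)) 7≤n) ⟩
    (n ∸ 2) ! ℕ.* (2 ℕ.* n ℕ.* (n ∸ 1))      ≤⟨ *-monoʳ-≤ ((n ∸ 2) !) (m+n≤o⇒m≤o∸n _ A-B) ⟩
    (n ∸ 2) ! ℕ.* (A ∸ B)                   ∎
    where open ≤-Reasoning
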